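{- For all $k\ge1$, as formal power series in $t$, $$\sum_{n\ge k}\mathbf{Sf}_{n,k}(p,q)\,t^n=\frac{t^k}{(1-F_1(p,q)t)(1-F_2(p,q)t)\cdots(1-F_k(p,q)t)}.$$
   Context: $F_1(p,q)=q$, $F_2(p,q)=q^2$ and $F_m(p,q)=qF_{m-1}(p,q)+pF_{m-2}(p,q)$ for $m\ge3$. Let $(x)_{\downarrow_{F,p,q,0}}=1$ and $(x)_{\downarrow_{F,p,q,k}}=x(x-F_1(p,q))\cdots(x-F_{k-1}(p,q))$ for $k\ge1$. Define $\mathbf{Sf}_{n,k}(p,q)$ for $0\le k\le n$ by $x^n=\sum_{k=0}^n\mathbf{Sf}_{n,k}(p,q)(x)_{\downarrow_{F,p,q,k}}$. -}

module Defs where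

open import Algebra.Bundles using (CommutativeRing; RawRing)
import Algebra.Definitions.RawSemiring
import Algebra.Properties.Semiring.Sum
open import Data.Bool.Base using (if_then_else_)
open import Data.Fin.Base using (Fin; zero; suc; toℕ)
open import Data.Nat.Base using (ℕ; zero; suc; _∸_; _≤ᵇ_)
open import Data.Vec.Functional using (Vector; _∷_)
open import Relation.Binary.PropositionalEquality.Core as ≡ using (_≡_)

-- Formal power series over R in one variable, as coefficient sequences.
-- R[x] is the subring of finitely supported sequences, and two polynomials
-- are equal in R[x] iff they are equal as series, so polynomial identities
-- are stated here as well.
module PowerSeries {c ℓ} (R : CommutativeRing c ℓ) where

  private module R = CommutativeRing R
  open R using () renaming (Carrier to A)
  open Algebra.Properties.Semiring.Sum R.semiring
    using (sum; sum⁺-syntax; sum-cong-≋)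

  Series : Set c
  Series = ℕ → A

  rawRing : RawRing c ℓ
  rawRing = record
    { Carrier = Series
    ; _≈_     = λ f g → ∀ n → f n R.≈ g n
    ; _+_     = λ f g n → f n R.+ g n
    ; _*_     = λ f g n → ∑[ i ≤ n ] (f (toℕ i) R.* g (n ∸ toℕ i))
    ; -_      = λ f n → R.- f n
    ; 0#      = λ _ → R.0#
    ; 1#      = λ { zero → R.1# ; (suc _) → R.0# }
    }

  open RawRing rawRing public
    using (_≈_; _+_; _*_; -_; 0#; 1#; rawSemiring)
  open Algebra.Definitions.RawSemiring rawSemiring public
    using (_^_; product) renaming (sum to sumₛ)

  infixl 6 _-_
  _-_ : Series → Series → Series
  f - g = f + - g

  const : A → Series
  const a zero    = a
  const a (suc _) = R.0#

  X : Series
  X zero          = R.0#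
  X (suc zero)    = R.1#
  X (suc (suc _)) = R.0#

  -- The first n + 1 coefficients of the inverse of f, highest first, for f
  -- with constant coefficient 1: g₀ = 1 and g₍ₙ₊₁₎ = - ∑_{i ≤ n} f₍ᵢ₊₁₎ g₍ₙ₋ᵢ₎.
  inverseCoeffs : Series → (n : ℕ) → Vector A (suc n)
  inverseCoeffs f zero    = λ _ → R.1#
  inverseCoeffs f (suc n) =
    (R.- ∑[ i ≤ n ] (f (suc (toℕ i)) R.* inverseCoeffs f n i))
      ∷ inverseCoeffs f n

  -- Meaningful only when the constant coefficient is 1; see ⁻¹-inverseʳ.
  infix 8 _⁻¹
  _⁻¹ : Series → Series
  (f ⁻¹) n = inverseCoeffs f n zero

  infixl 7 _/_
  _/_ : Series → Series → Series
  f / g = f * g ⁻¹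

  inverseCoeffs-⁻¹ : ∀ f n (i : Fin (suc n)) →
                     inverseCoeffs f n i ≡ (f ⁻¹) (n ∸ toℕ i)
  inverseCoeffs-⁻¹ f zero    zero    = ≡.refl
  inverseCoeffs-⁻¹ f (suc n) zero    = ≡.refl
  inverseCoeffs-⁻¹ f (suc n) (suc i) = inverseCoeffs-⁻¹ f n i

  ⁻¹-inverseʳ : ∀ f → f 0 R.≈ R.1# → f * f ⁻¹ ≈ 1#
  ⁻¹-inverseʳ f f₀≈1 zero =
    R.trans (R.+-identityʳ _) (R.trans (R.*-identityʳ _) f₀≈1)
  ⁻¹-inverseʳ f f₀≈1 (suc n) =
    R.trans
      (R.+-cong
        (R.trans (R.*-congʳ f₀≈1) (R.*-identityˡ _))
        (sum-cong-≋ λ i →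
          R.*-congˡ {x = f (suc (toℕ i))} (R.reflexive (≡.sym (inverseCoeffs-⁻¹ f n i)))))
      (R.-‿inverseˡ _)

module FibonacciStirling {c ℓ} (R : CommutativeRing c ℓ)
                         (p q : CommutativeRing.Carrier R) where

  private module R = CommutativeRing R
  open PowerSeries R
  import Algebra.Properties.Ring R.ring as Ringₚ

  -- The sequence starts at index 1; the value at 0 is never used.
  F : ℕ → R.Carrier
  F 0                   = R.0#
  F 1                   = q
  F 2                   = q R.* q
  F (suc (suc (suc m))) = q R.* F (suc (suc m)) R.+ p R.* F (suc m)

  -- (x)↓ₖ as a polynomial in x = X.
  falling : ℕ → Series
  falling 0             = 1#
  falling 1             = X
  falling (suc (suc k)) = falling (suc k) * (X - const (F (suc k)))

  -- The identities in R[x] that define Sf n k for k ≤ n.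
  -- Values of Sf n k with k > n are unconstrained.
  IsFibonacciStirling : (ℕ → ℕ → R.Carrier) → Set ℓ
  IsFibonacciStirling Sf =
    ∀ n → X ^ n ≈
      sumₛ {suc n} (λ k → const (Sf n (toℕ k)) * falling (toℕ k))

  -- ∑_{n ≥ k} Sf n k tⁿ
  columnSeries : (ℕ → ℕ → R.Carrier) → ℕ → Series
  columnSeries Sf k n = if k ≤ᵇ n then Sf n k else R.0#

  -- (1 - F₁ t) ⋯ (1 - Fₖ t) with t = X.
  denominator : ℕ → Series
  denominator k = product {k} (λ i → 1# - const (F (suc (toℕ i))) * X)

  private
    factor₀ : ∀ a → (1# - const a * X) 0 R.≈ R.1#
    factor₀ a =
      R.trans
        (R.+-congˡ
          (R.trans (R.-‿cong (R.trans (R.+-identityʳ _) (R.zeroʳ a)))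
                   Ringₚ.-0#≈0#))
        (R.+-identityʳ _)

    product₀ : ∀ k (f : Vector Series k) → (∀ i → f i 0 R.≈ R.1#) →
               product f 0 R.≈ R.1#
    product₀ zero    f f₀≈1 = R.refl
    product₀ (suc k) f f₀≈1 =
      R.trans (R.+-identityʳ _)
        (R.trans (R.*-cong (f₀≈1 zero)
                           (product₀ k (λ i → f (suc i)) (λ i → f₀≈1 (suc i))))
                 (R.*-identityˡ _))

  -- Hence _/ denominator k is genuine division.
  denominator₀ : ∀ k → denominator k 0 R.≈ R.1#
  denominator₀ k = product₀ k _ (λ i → factor₀ (F (suc (toℕ i))))

{-# OPTIONS --safe #-}

-- The numbers S n k with S (n+1) (k+1) = S n k + F (k+1) S n (k+1) satisfy the
-- defining identities, because x (x)↓ₖ = (x)↓ₖ₊₁ + Fₖ (x)↓ₖ, where F 0 = 0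
-- makes the case k = 0 uniform. As (x)↓ₖ is monic of degree k, comparing
-- leading coefficients shows that any Sf agrees with S for k ≤ n. For the
-- columns of S the recurrence says (1 - Fₖ₊₁ t) Cₖ₊₁ = t Cₖ, whence
-- Cₖ (1 - F₁ t) ⋯ (1 - Fₖ t) = tᵏ.
module Submission where

open import Algebra.Bundles using (AbelianGroup; CommutativeMonoid; CommutativeRing; Monoid)
import Algebra.Consequences.Setoid as Consequences
import Algebra.Construct.Pointwise as Pointwise
import Algebra.Properties.CommutativeSemigroup
import Algebra.Properties.Monoid.Sum
import Algebra.Properties.Ring
import Algebra.Properties.Semiring.Sum
open import Data.Bool.Base using (true; false)
open import Data.Fin.Base using (zero; suc; toℕ)
open import Data.Fin.Properties using (toℕ-fromℕ; toℕ-inject₁; toℕ<n)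
open import Data.Nat.Base using (ℕ; zero; suc; _∸_; _≤_; _<_; _≥_; _≤ᵇ_; s≤s; s<s⁻¹)
open import Data.Nat.Properties
  using (≤ᵇ-reflects-≤; ≰⇒>; m<1+n⇒m<n∨m≡n; m<n⇒m<1+n; n<1+n)
open import Data.Sum.Base using (inj₁; inj₂)
open import Data.Vec.Functional using (Vector)
open import Function.Base using (_∘_)
open import Relation.Binary.PropositionalEquality.Core as ≡ using ()
import Relation.Binary.Reasoning.Setoid
open import Relation.Nullary.Reflects using (ofʸ; ofⁿ)
open import Defs

-- Finite sums in a monoid.

module _ {a ℓ} (M : Monoid a ℓ) where

  open Monoid M
  open Algebra.Properties.Monoid.Sum M

  -- Stated for any monoid so that it also splits the last factor off a product, which is how
  -- `denominator` grows with k.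
  sum-snoc : ∀ (g : ℕ → Carrier) n →
             ∑[ i ≤ n ] g (toℕ i) ≈ (∑[ i < n ] g (toℕ i)) ∙ g n
  sum-snoc g n = trans (sum-init-last (g ∘ toℕ))
    (∙-cong (sum-cong-≋ {n} (λ i → reflexive (≡.cong g (toℕ-inject₁ i))))
            (reflexive (≡.cong g (toℕ-fromℕ n))))

  -- Both sides are the sum of `g` over 0 to n + 1 with one vanishing end term left out: the top one
  -- on the left, the bottom one on the right.
  sum-shift : ∀ (g : ℕ → Carrier) n → g 0 ≈ ε → g (suc n) ≈ ε →
              ∑[ i ≤ n ] g (toℕ i) ≈ ∑[ i ≤ n ] g (suc (toℕ i))
  sum-shift g n g₀≈ε gₙ₊₁≈ε = begin
    ∑[ i ≤ n ] g (toℕ i)              ≈⟨ identityʳ _ ⟨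
    ∑[ i ≤ n ] g (toℕ i) ∙ ε          ≈⟨ ∙-congˡ gₙ₊₁≈ε ⟨
    ∑[ i ≤ n ] g (toℕ i) ∙ g (suc n)  ≈⟨ sum-snoc g (suc n) ⟨
    g 0 ∙ ∑[ i ≤ n ] g (suc (toℕ i))  ≈⟨ ∙-congʳ g₀≈ε ⟩
    ε ∙ ∑[ i ≤ n ] g (suc (toℕ i))    ≈⟨ identityˡ _ ⟩
    ∑[ i ≤ n ] g (suc (toℕ i))        ∎
    where open Relation.Binary.Reasoning.Setoid setoid

-- The commutative ring of formal power series.

module PowerSeriesProperties {c ℓ} (R : CommutativeRing c ℓ) where

  private module R = CommutativeRing R
  open R using () renaming (Carrier to A)
  open PowerSeries R
  open Algebra.Properties.Semiring.Sum R.semiring using (sum-cong-≋)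
  open Algebra.Properties.CommutativeSemigroup
    (CommutativeMonoid.commutativeSemigroup R.+-commutativeMonoid)
    using (interchange; x∙yz≈y∙xz)
  open Relation.Binary.Reasoning.Setoid R.setoid

  tail : Series → Series
  tail f = f ∘ suc

  infixr 8 _·_
  _·_ : A → Series → Series
  (a · f) n = a R.* f n

  -- Definitionally tail (f * g) is f 0 · tail g + tail f * g, so the ring laws
  -- follow by induction on the index.

  *-cong : ∀ {f f′ g g′} → f ≈ f′ → g ≈ g′ → f * g ≈ f′ * g′
  *-cong f≈f′ g≈g′ n =
    sum-cong-≋ {suc n} λ i → R.*-cong (f≈f′ (toℕ i)) (g≈g′ (n ∸ toℕ i))

  zeroˡ : ∀ f → 0# * f ≈ 0#
  zeroˡ f zero    = R.trans (R.+-identityʳ _) (R.zeroˡ _)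
  zeroˡ f (suc n) =
    R.trans (R.+-cong (R.zeroˡ _) (zeroˡ f n)) (R.+-identityˡ _)

  -- The tail of `const a` is `0#`, so only the first term of the convolution survives.
  const-* : ∀ a f → const a * f ≈ a · f
  const-* a f zero    = R.+-identityʳ _
  const-* a f (suc n) = R.trans (R.+-congˡ (zeroˡ f n)) (R.+-identityʳ _)

  const-1 : const R.1# ≈ 1#
  const-1 zero    = R.refl
  const-1 (suc n) = R.refl

  *-identityˡ : ∀ f → 1# * f ≈ f
  *-identityˡ f n = begin
    (1# * f) n          ≈⟨ *-cong {1#} {const R.1#} {f} {f} (R.sym ∘ const-1) (λ _ → R.refl) n ⟩
    (const R.1# * f) n  ≈⟨ const-* R.1# f n ⟩
    R.1# R.* f n        ≈⟨ R.*-identityˡ (f n) ⟩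
    f n                 ∎

  distribʳ : ∀ h f g → (f + g) * h ≈ f * h + g * h
  distribʳ h f g zero    = begin
    (f 0 R.+ g 0) R.* h 0 R.+ R.0#  ≈⟨ R.+-identityʳ _ ⟩
    (f 0 R.+ g 0) R.* h 0           ≈⟨ R.distribʳ _ _ _ ⟩
    f 0 R.* h 0 R.+ g 0 R.* h 0     ≈⟨ R.+-cong (R.+-identityʳ _) (R.+-identityʳ _) ⟨
    (f * h + g * h) 0               ∎
  distribʳ h f g (suc n) = begin
    (f 0 R.+ g 0) R.* h (suc n) R.+ ((tail f + tail g) * h) n
      ≈⟨ R.+-cong (R.distribʳ _ _ _) (distribʳ h (tail f) (tail g) n) ⟩
    (f 0 R.* h (suc n) R.+ g 0 R.* h (suc n)) R.+ ((tail f * h) n R.+ (tail g * h) n)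
      ≈⟨ interchange _ _ _ _ ⟩
    (f * h + g * h) (suc n) ∎

  -- Handles the summand `f 0 · tail g` of `tail (f * g)` in the induction for associativity.
  ·-*-assoc : ∀ a f g → (a · f) * g ≈ a · (f * g)
  ·-*-assoc a f g zero    = begin
    a R.* f 0 R.* g 0 R.+ R.0#      ≈⟨ R.+-identityʳ _ ⟩
    a R.* f 0 R.* g 0               ≈⟨ R.*-assoc _ _ _ ⟩
    a R.* (f 0 R.* g 0)             ≈⟨ R.*-congˡ (R.+-identityʳ _) ⟨
    a R.* (f 0 R.* g 0 R.+ R.0#)    ∎
  ·-*-assoc a f g (suc n) = begin
    a R.* f 0 R.* g (suc n) R.+ ((a · tail f) * g) n
      ≈⟨ R.+-cong (R.*-assoc _ _ _) (·-*-assoc a (tail f) g n) ⟩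
    a R.* (f 0 R.* g (suc n)) R.+ a R.* (tail f * g) n
      ≈⟨ R.distribˡ _ _ _ ⟨
    (a · (f * g)) (suc n) ∎

  *-assoc : ∀ f g h → (f * g) * h ≈ f * (g * h)
  *-assoc f g h zero    = begin
    (f 0 R.* g 0 R.+ R.0#) R.* h 0 R.+ R.0#   ≈⟨ R.+-identityʳ _ ⟩
    (f 0 R.* g 0 R.+ R.0#) R.* h 0            ≈⟨ R.*-congʳ (R.+-identityʳ _) ⟩
    f 0 R.* g 0 R.* h 0                       ≈⟨ R.*-assoc _ _ _ ⟩
    f 0 R.* (g 0 R.* h 0)                     ≈⟨ R.*-congˡ (R.+-identityʳ _) ⟨
    f 0 R.* (g 0 R.* h 0 R.+ R.0#)            ≈⟨ R.+-identityʳ _ ⟨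
    (f * (g * h)) 0                           ∎
  *-assoc f g h (suc n) = begin
    (f 0 R.* g 0 R.+ R.0#) R.* h (suc n) R.+ ((f 0 · tail g + tail f * g) * h) n
      ≈⟨ R.+-cong (R.trans (R.*-congʳ (R.+-identityʳ _)) (R.*-assoc _ _ _))
                  (distribʳ h (f 0 · tail g) (tail f * g) n) ⟩
    f 0 R.* (g 0 R.* h (suc n)) R.+ (((f 0 · tail g) * h) n R.+ ((tail f * g) * h) n)
      ≈⟨ R.+-assoc _ _ _ ⟨
    f 0 R.* (g 0 R.* h (suc n)) R.+ ((f 0 · tail g) * h) n R.+ ((tail f * g) * h) n
      ≈⟨ R.+-cong (R.+-congˡ (·-*-assoc (f 0) (tail g) h n)) (*-assoc (tail f) g h n) ⟩
    f 0 R.* (g 0 R.* h (suc n)) R.+ f 0 R.* (tail g * h) n R.+ (tail f * (g * h)) n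
      ≈⟨ R.+-congʳ (R.distribˡ _ _ _) ⟨
    (f * (g * h)) (suc n) ∎

  -- The mirror image of the definitional unfolding: the term split off contains the constant
  -- coefficient of `g` instead of that of `f`. Commutativity uses it to unfold `g * f` in step with
  -- `f * g`.
  *-sucʳ : ∀ f g n → (f * g) (suc n) R.≈ f (suc n) R.* g 0 R.+ (f * tail g) n
  *-sucʳ f g zero    = begin
    f 0 R.* g 1 R.+ (f 1 R.* g 0 R.+ R.0#)  ≈⟨ x∙yz≈y∙xz _ _ _ ⟩
    f 1 R.* g 0 R.+ (f * tail g) 0          ∎
  *-sucʳ f g (suc n) = begin
    f 0 R.* g (suc (suc n)) R.+ (tail f * g) (suc n)
      ≈⟨ R.+-congˡ (*-sucʳ (tail f) g n) ⟩
    f 0 R.* g (suc (suc n)) R.+ (f (suc (suc n)) R.* g 0 R.+ (tail f * tail g) n)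
      ≈⟨ x∙yz≈y∙xz _ _ _ ⟩
    f (suc (suc n)) R.* g 0 R.+ (f * tail g) (suc n) ∎

  *-comm : ∀ f g → f * g ≈ g * f
  *-comm f g zero    = R.+-congʳ (R.*-comm _ _)
  *-comm f g (suc n) = begin
    f 0 R.* g (suc n) R.+ (tail f * g) n  ≈⟨ R.+-cong (R.*-comm _ _) (*-comm (tail f) g n) ⟩
    g (suc n) R.* f 0 R.+ (g * tail f) n  ≈⟨ *-sucʳ g f n ⟨
    (g * f) (suc n)                       ∎

  commutativeRing : CommutativeRing c ℓ
  commutativeRing = record
    { Carrier = Series
    ; _≈_     = _≈_
    ; _+_     = _+_
    ; _*_     = _*_
    ; -_      = -_
    ; 0#      = 0#
    ; 1#      = 1#
    ; isCommutativeRing = record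
      { isRing = record
        { +-isAbelianGroup = +.isAbelianGroup
        ; *-cong     = λ {f} {f′} {g} {g′} → *-cong {f} {f′} {g} {g′}
        ; *-assoc    = *-assoc
        ; *-identity = comm∧idˡ⇒id *-comm *-identityˡ
        ; distrib    = comm∧distrʳ⇒distr
                         (λ {f} {f′} {g} {g′} → +.∙-cong {f} {f′} {g} {g′})
                         *-comm distribʳ
        }
      ; *-comm = *-comm
      }
    }
    where
    module + = AbelianGroup (Pointwise.abelianGroup ℕ R.+-abelianGroup)
    open Consequences +.setoid

  X-*-suc : ∀ f n → (X * f) (suc n) R.≈ f n
  X-*-suc f n = begin
    R.0# R.* f (suc n) R.+ (tail X * f) n  ≈⟨ R.+-congʳ (R.zeroˡ _) ⟩
    R.0# R.+ (tail X * f) n                ≈⟨ R.+-identityˡ _ ⟩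
    (tail X * f) n                         ≈⟨ *-cong {tail X} {1#} {f} {f} tail-X (λ _ → R.refl) n ⟩
    (1# * f) n                             ≈⟨ *-identityˡ f n ⟩
    f n                                    ∎
    where
    tail-X : tail X ≈ 1#
    tail-X zero    = R.refl
    tail-X (suc _) = R.refl

  X-*-zero : ∀ f → (X * f) 0 R.≈ R.0#
  X-*-zero f = R.trans (R.+-identityʳ _) (R.zeroˡ _)

  sum-coeff≈0 : ∀ {m} (fs : Vector Series m) n → (∀ i → fs i n R.≈ R.0#) →
                sumₛ fs n R.≈ R.0#
  sum-coeff≈0 {zero}  fs n fs≈0 = R.refl
  sum-coeff≈0 {suc m} fs n fs≈0 =
    R.trans (R.+-cong (fs≈0 zero) (sum-coeff≈0 (fs ∘ suc) n (fs≈0 ∘ suc)))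
            (R.+-identityˡ _)

  -- Multiplying by `g ⁻¹` undoes the factor `g`; it is a true inverse because the constant
  -- coefficient of `g` is 1.
  *-/ : ∀ f g h → g 0 R.≈ R.1# → f * g ≈ h → f ≈ h / g
  *-/ f g h g₀≈1 fg≈h = R[[X]].trans (R[[X]].sym (R[[X]].*-identityʳ f))
    (R[[X]].trans (*-cong {f} {f} {1#} {g * g ⁻¹} (λ _ → R.refl) (R.sym ∘ ⁻¹-inverseʳ g g₀≈1))
    (R[[X]].trans (R.sym ∘ *-assoc f g (g ⁻¹))
                  (*-cong {f * g} {h} {g ⁻¹} {g ⁻¹} fg≈h (λ _ → R.refl))))
    where module R[[X]] = CommutativeRing commutativeRing

module FibonacciStirlingProperties {c ℓ} (R : CommutativeRing c ℓ)
                                   (p q : CommutativeRing.Carrier R) where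

  private module R = CommutativeRing R
  open R using () renaming (Carrier to A)
  open PowerSeries R
  open PowerSeriesProperties R
  open FibonacciStirling R p q
  private
    module S = CommutativeRing commutativeRing
    module Sₚ = Algebra.Properties.Ring S.ring
    module Σ = Algebra.Properties.Semiring.Sum S.semiring
    module *ₚ = Algebra.Properties.CommutativeSemigroup
      (CommutativeMonoid.commutativeSemigroup S.*-commutativeMonoid)
  open Relation.Binary.Reasoning.Setoid S.setoid

  -- The numbers given by the recurrence.

  stirling : ℕ → ℕ → A
  stirling zero    zero    = R.1#
  stirling zero    (suc k) = R.0#
  stirling (suc n) zero    = R.0#
  stirling (suc n) (suc k) = stirling n k R.+ F (suc k) R.* stirling n (suc k)

  -- Serves twice: it kills the top boundary term when sums are reindexed, and it matches the
  -- default zero of `columnSeries`.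
  stirling≈0 : ∀ {n k} → n < k → stirling n k R.≈ R.0#
  stirling≈0 {zero}  {suc k} _   = R.refl
  stirling≈0 {suc n} {suc k} n<k =
    R.trans (R.+-cong (stirling≈0 (s<s⁻¹ n<k))
                      (R.trans (R.*-congˡ (stirling≈0 (m<n⇒m<1+n (s<s⁻¹ n<k)))) (R.zeroʳ _)))
            (R.+-identityˡ _)

  -- Falling factorials as monic polynomials.

  falling-suc : ∀ k → falling (suc k) ≈ falling k * (X - const (F k))
  falling-suc zero    = begin
    X                       ≈⟨ S.+-identityʳ X ⟨
    X + 0#                  ≈⟨ S.+-congˡ {X} (S.sym Sₚ.-0#≈0#) ⟩
    X - 0#                  ≈⟨ S.+-congˡ {X} (S.-‿cong {0#} {const R.0#} const-0) ⟩
    -- `F 0` reduces to `R.0#`, so this is the factor required at k = 0.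
    X - const R.0#          ≈⟨ S.*-identityˡ _ ⟨
    1# * (X - const R.0#)   ∎
    where
    const-0 : 0# ≈ const R.0#
    const-0 zero    = R.refl
    const-0 (suc n) = R.refl
  falling-suc (suc k) = S.refl

  X*falling : ∀ k → X * falling k ≈ falling (suc k) + const (F k) * falling k
  X*falling k = begin
    X * x↓                              ≈⟨ Sₚ.//-rightDividesˡ (a * x↓) (X * x↓) ⟨
    (X * x↓ - a * x↓) + a * x↓          ≈⟨ S.+-congʳ {a * x↓} (Sₚ.[y-z]x≈yx-zx x↓ X a) ⟨
    (X - a) * x↓ + a * x↓               ≈⟨ S.+-congʳ {a * x↓} (S.*-comm (X - a) x↓) ⟩
    x↓ * (X - a) + a * x↓               ≈⟨ S.+-congʳ {a * x↓} (falling-suc k) ⟨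
    falling (suc k) + a * x↓            ∎
    where
    a  = const (F k)
    x↓ = falling k

  -- Compare coefficients of index n + 1 in `X*falling`: multiplication by `X` shifts the index down
  -- to n, and the hypothesis removes the term scaled by `F k`. Both the degree bound and monicity
  -- follow from this by induction on k.
  falling-coeff-suc : ∀ k n → falling k (suc n) R.≈ R.0# →
                      falling (suc k) (suc n) R.≈ falling k n
  falling-coeff-suc k n x↓≈0 =
    R.trans (R.sym (R.trans (R.+-congˡ scaled≈0) (R.+-identityʳ _)))
    (R.trans (R.sym (X*falling k (suc n))) (X-*-suc (falling k) n))
    where
    scaled≈0 : (const (F k) * falling k) (suc n) R.≈ R.0#
    scaled≈0 = R.trans (const-* (F k) (falling k) (suc n))
                       (R.trans (R.*-congˡ x↓≈0) (R.zeroʳ _))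

  falling-degree : ∀ {k n} → k < n → falling k n R.≈ R.0#
  falling-degree {zero}  {suc n} _   = R.refl
  falling-degree {suc k} {suc n} k<n =
    R.trans (falling-coeff-suc k n (falling-degree (m<n⇒m<1+n (s<s⁻¹ k<n))))
            (falling-degree (s<s⁻¹ k<n))

  falling-monic : ∀ k → falling k k R.≈ R.1#
  falling-monic zero    = R.refl
  falling-monic (suc k) =
    R.trans (falling-coeff-suc k k (falling-degree (n<1+n k))) (falling-monic k)

  -- Uniqueness of expansions in falling factorials.

  -- Here n counts the terms, so the defining identity for row n concerns
  -- `combination (Sf n) (suc n)`, and an induction can start from the empty sum.
  combination : (ℕ → A) → ℕ → Series
  combination a n = sumₛ {n} (λ k → const (a (toℕ k)) * falling (toℕ k))

  combination-suc : ∀ a n →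
                    combination a (suc n) ≈ combination a n + const (a n) * falling n
  combination-suc a = sum-snoc S.+-monoid (λ k → const (a k) * falling k)

  -- The terms below the last have degree less than n, and the last is a multiple of a monic
  -- polynomial of degree n.
  combination-leading : ∀ a n → combination a (suc n) n R.≈ a n
  combination-leading a n =
    R.trans (combination-suc a n n)
    (R.trans (R.+-cong
               (sum-coeff≈0 {n} _ n λ k →
                 R.trans (const-* _ (falling (toℕ k)) n)
                         (R.trans (R.*-congˡ (falling-degree (toℕ<n k))) (R.zeroʳ _)))
               (R.trans (const-* _ (falling n) n)
                        (R.trans (R.*-congˡ (falling-monic n)) (R.*-identityʳ _))))
             (R.+-identityˡ _))

  const-cong : ∀ {a b} → a R.≈ b → const a ≈ const b
  const-cong a≈b zero    = a≈b
  const-cong a≈b (suc _) = R.refl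

  -- Triangularity: the leading coefficients agree, so the top terms cancel and the shorter
  -- combinations are again equal.
  combination-injective : ∀ a b n → combination a n ≈ combination b n →
                          ∀ {k} → k < n → a k R.≈ b k
  combination-injective a b (suc n) eq k<1+n with m<1+n⇒m<n∨m≡n k<1+n
    -- Both cases need this equation `a n ≈ b n`: it is the claim when k = n, and it permits the
    -- cancellation when k < n.
    | R.trans (R.sym (combination-leading a n)) (R.trans (eq n) (combination-leading b n))
  ... | inj₂ ≡.refl | leading = leading
  ... | inj₁ k<n    | leading = combination-injective a b n
    (Sₚ.+-cancelʳ (const (a n) * falling n) (combination a n) (combination b n) (begin
      combination a n + const (a n) * falling n  ≈⟨ combination-suc a n ⟨
      combination a (suc n)                      ≈⟨ eq ⟩
      combination b (suc n)                      ≈⟨ combination-suc b n ⟩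
      combination b n + const (b n) * falling n  ≈⟨ S.+-congˡ {combination b n} (S.*-congʳ {falling n} {const (a n)} {const (b n)} (const-cong leading)) ⟨
      combination b n + const (a n) * falling n  ∎)) k<n

  -- Existence of the expansion, and agreement of every `Sf` with `stirling`.

  stirling-isFibonacciStirling : IsFibonacciStirling stirling
  stirling-isFibonacciStirling zero    = begin
    1#                        ≈⟨ const-1 ⟨
    const R.1#                ≈⟨ S.*-identityʳ _ ⟨
    const R.1# * 1#           ≈⟨ S.+-identityʳ _ ⟨
    const R.1# * 1# + 0#      ∎
  stirling-isFibonacciStirling (suc n) = begin
    X * X ^ n
      ≈⟨ S.*-congˡ {X} {X ^ n} (stirling-isFibonacciStirling n) ⟩
    X * ∑[ k < suc n ] term (toℕ k)
      ≈⟨ Σ.*-distribˡ-sum {suc n} X (λ k → term (toℕ k)) ⟩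
    ∑[ k < suc n ] (X * term (toℕ k))
      ≈⟨ Σ.sum-cong-≋ {suc n} (λ k → X*term (toℕ k)) ⟩
    ∑[ k < suc n ] (raised (toℕ k) + scaled (toℕ k))
      ≈⟨ Σ.∑-distrib-+ {suc n} (λ k → raised (toℕ k)) (λ k → scaled (toℕ k)) ⟩
    ∑[ k < suc n ] raised (toℕ k) + ∑[ k < suc n ] scaled (toℕ k)
      -- Shifting `scaled` by one lines it up with `raised`, so that both carry `falling (suc k)`.
      -- The end terms vanish because `F 0` is zero and because `stirling n (suc n)` is zero.
      ≈⟨ S.+-congˡ {∑[ k < suc n ] raised (toℕ k)} (sum-shift S.+-monoid scaled n scaled₀≈0 scaledₙ₊₁≈0) ⟩
    ∑[ k < suc n ] raised (toℕ k) + ∑[ k < suc n ] scaled (suc (toℕ k))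
      ≈⟨ Σ.∑-distrib-+ {suc n} (λ k → raised (toℕ k)) (λ k → scaled (suc (toℕ k))) ⟨
    ∑[ k < suc n ] (raised (toℕ k) + scaled (suc (toℕ k)))
      ≈⟨ Σ.sum-cong-≋ {suc n} (λ k → raised+scaled (toℕ k)) ⟩
    ∑[ k < suc n ] term′ (suc (toℕ k))
      ≈⟨ S.+-identityˡ _ ⟨
    0# + ∑[ k < suc n ] term′ (suc (toℕ k))
      ≈⟨ S.+-congʳ {∑[ k < suc n ] term′ (suc (toℕ k))} term′₀≈0 ⟨
    term′ 0 + ∑[ k < suc n ] term′ (suc (toℕ k)) ∎
    where
    open Σ using (sum-syntax)
    -- Multiplying `term k` by `X` splits it into `raised k`, one falling factorial higher, and
    -- `scaled k`, which stays at `falling k` and gains the scalar `F k`.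
    term term′ raised scaled : ℕ → Series
    term k   = const (stirling n k) * falling k
    term′ k  = const (stirling (suc n) k) * falling k
    raised k = const (stirling n k) * falling (suc k)
    scaled k = const (F k R.* stirling n k) * falling k

    term′₀≈0 : term′ 0 ≈ 0#
    term′₀≈0 m = R.trans (const-* R.0# 1# m) (R.zeroˡ _)

    scaled₀≈0 : scaled 0 ≈ 0#
    scaled₀≈0 m = R.trans (const-* _ 1# m) (R.trans (R.*-congʳ (R.zeroˡ _)) (R.zeroˡ _))

    scaledₙ₊₁≈0 : scaled (suc n) ≈ 0#
    scaledₙ₊₁≈0 m =
      R.trans (const-* _ (falling (suc n)) m)
      (R.trans (R.*-congʳ (R.trans (R.*-congˡ (stirling≈0 (n<1+n n))) (R.zeroʳ _)))
               (R.zeroˡ _))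

    X*term : ∀ k → X * term k ≈ raised k + scaled k
    X*term k = begin
      X * (s * falling k)                           ≈⟨ *ₚ.x∙yz≈y∙xz X s (falling k) ⟩
      s * (X * falling k)                           ≈⟨ S.*-congˡ {s} {X * falling k} {falling (suc k) + a * falling k} (X*falling k) ⟩
      s * (falling (suc k) + a * falling k)         ≈⟨ S.distribˡ s (falling (suc k)) (a * falling k) ⟩
      s * falling (suc k) + s * (a * falling k)     ≈⟨ S.+-congˡ {raised k} (*ₚ.x∙yz≈yx∙z s a (falling k)) ⟩
      s * falling (suc k) + (a * s) * falling k     ≈⟨ S.+-congˡ {raised k} (S.*-congʳ {falling k} {a * s} {const (F k R.* stirling n k)} const-homo) ⟩
      raised k + scaled k                           ∎
      where
      s = const (stirling n k)
      a = const (F k)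
      const-homo : a * s ≈ const (F k R.* stirling n k)
      const-homo zero    = const-* _ s 0
      const-homo (suc m) = R.trans (const-* _ s (suc m)) (R.zeroʳ _)

    raised+scaled : ∀ k → raised k + scaled (suc k) ≈ term′ (suc k)
    raised+scaled k m =
      R.trans (R.+-cong (const-* _ (falling (suc k)) m) (const-* _ (falling (suc k)) m))
      -- The two scalars add up to `stirling (suc n) (suc k)` by definition.
      (R.trans (R.sym (R.distribʳ _ _ _)) (R.sym (const-* _ (falling (suc k)) m)))

  stirling-unique : ∀ Sf → IsFibonacciStirling Sf →
                    ∀ {n k} → k ≤ n → Sf n k R.≈ stirling n k
  stirling-unique Sf isSf {n} k≤n =
    combination-injective (Sf n) (stirling n) (suc n)
      (S.trans (S.sym (isSf n)) (stirling-isFibonacciStirling n)) (s≤s k≤n)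

  -- Generating functions of the columns.

  column : ℕ → Series
  column k n = stirling n k

  -- Uniqueness settles the coefficients with k ≤ n. For the others the cutoff in `columnSeries`
  -- gives zero, as does `stirling`, which is why `column` carries no cutoff.
  columnSeries≈column : ∀ Sf → IsFibonacciStirling Sf →
                        ∀ k → columnSeries Sf k ≈ column k
  columnSeries≈column Sf isSf k n with k ≤ᵇ n | ≤ᵇ-reflects-≤ k n
  ... | true  | ofʸ k≤n = stirling-unique Sf isSf k≤n
  ... | false | ofⁿ k≰n = R.sym (stirling≈0 (≰⇒> k≰n))

  column-zero : column 0 ≈ 1#
  column-zero zero    = R.refl
  column-zero (suc n) = R.refl

  -- Coefficientwise, the recurrence of `stirling` reads `C ≈ X * column k + C * (a * X)`;
  -- subtracting the last term gives the claim.
  column-suc : ∀ k → column (suc k) * (1# - const (F (suc k)) * X) ≈ X * column k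
  column-suc k = begin
    C * (1# - a * X)                     ≈⟨ Sₚ.x[y-z]≈xy-xz C 1# (a * X) ⟩
    C * 1# - C * (a * X)                 ≈⟨ S.+-congʳ {S.- (C * (a * X))} (S.*-identityʳ C) ⟩
    C - C * (a * X)                      ≈⟨ S.+-congʳ {S.- (C * (a * X))} recurrence ⟩
    X * column k + C * (a * X) - C * (a * X)
                                         ≈⟨ Sₚ.//-rightDividesʳ (C * (a * X)) (X * column k) ⟩
    X * column k                         ∎
    where
    C = column (suc k)
    a = const (F (suc k))
    -- With `X` in front, the product is an index shift.
    rotate : C * (a * X) ≈ X * (a * C)
    rotate = *ₚ.x∙yz≈z∙yx C a X
    recurrence : C ≈ X * column k + C * (a * X)
    -- At index 0 the left side `stirling 0 (suc k)` is zero, and both terms on the right are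
    -- multiples of `X`.
    recurrence zero    = R.sym
      (R.trans (R.+-cong (X-*-zero (column k)) (R.trans (rotate 0) (X-*-zero (a * C))))
               (R.+-identityˡ _))
    recurrence (suc n) = R.sym
      (R.+-cong (X-*-suc (column k) n)
                (R.trans (rotate (suc n)) (R.trans (X-*-suc (a * C) n) (const-* _ C n))))

  -- `product` unfolds at its first factor, whereas the passage from column k to column k + 1
  -- contributes the last one.
  denominator-suc : ∀ k →
    denominator (suc k) ≈ denominator k * (1# - const (F (suc k)) * X)
  denominator-suc = sum-snoc S.*-monoid (λ i → 1# - const (F (suc i)) * X)

  column*denominator : ∀ k → column k * denominator k ≈ X ^ k
  column*denominator zero    = S.trans (S.*-identityʳ (column 0)) column-zero
  column*denominator (suc k) = begin
    C * denominator (suc k)   ≈⟨ S.*-congˡ {C} {denominator (suc k)} {D * f} (denominator-suc k) ⟩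
    -- The new factor `f` is moved next to `C`, where `column-suc` trades it for one power of `X`.
    C * (D * f)               ≈⟨ *ₚ.x∙yz≈xz∙y C D f ⟩
    (C * f) * D               ≈⟨ S.*-congʳ {D} {C * f} {X * column k} (column-suc k) ⟩
    (X * column k) * D        ≈⟨ S.*-assoc X (column k) D ⟩
    X * (column k * D)        ≈⟨ S.*-congˡ {X} {column k * D} {X ^ k} (column*denominator k) ⟩
    X * X ^ k                 ∎
    where
    C = column (suc k)
    D = denominator k
    f = 1# - const (F (suc k)) * X

theorem10 : ∀ {c ℓ} (R : CommutativeRing c ℓ) (p q : CommutativeRing.Carrier R) →
    let open PowerSeries R
        open FibonacciStirling R p q in
    (Sf : ℕ → ℕ → CommutativeRing.Carrier R) → IsFibonacciStirling Sf →
    ∀ (k : ℕ) → k ≥ 1 →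
    columnSeries Sf k ≈ X ^ k / denominator k
theorem10 R p q Sf isSf k _ =
  S.trans (columnSeries≈column Sf isSf k)
          (*-/ (column k) (denominator k) (X ^ k) (denominator₀ k) (column*denominator k))
  where
  open PowerSeries R
  open PowerSeriesProperties R
  open FibonacciStirling R p q
  open FibonacciStirlingProperties R p q
  module S = CommutativeRing commutativeRing
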